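{- Let $i,j,k\in\mathbb{Z}$ with $|i|\ge |j|$ and $|i|\ge |k|$. The number $f_{26N}(i,j,k)$ of shortest paths from $q=(0,0,0)$ to $p=(i,j,k)$ in the 26-neighborhood of the cubic grid $\mathbb{Z}^3$ is $$f_{26N}(i,j,k)=\left(\sum_{\substack{b\ge 0\\ 2b\le |i|-|j|}}\frac{|i|!}{b!\,(|j|+b)!\,(|i|-|j|-2b)!}\right)\times\left(\sum_{\substack{a\ge 0\\ 2a\le |i|-|k|}}\frac{|i|!}{a!\,(|k|+a)!\,(|i|-|k|-2a)!}\right),$$ where the sums are over integers $b$ and $a$; that is, $f_{26N}(i,j,k)=f_8(i,j)\times f_8(i,k)$, where $f_8(m,n)$ denotes the number of shortest paths from $(0,0)$ to $(m,n)$ in the 8-neighborhood of $\mathbb{Z}^2$.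
   Context: The cubic grid is $\mathbb{Z}^3$. For $r=(x_r,y_r,z_r)\in\mathbb{Z}^3$, its 26-neighborhood $N_{26}(r)$ is the set of points $s=(x_s,y_s,z_s)\in\mathbb{Z}^3$ with $\max\{|x_r-x_s|,|y_r-y_s|,|z_r-z_s|\}\le 1$ (equivalently, additionally $|x_r-x_s|+|y_r-y_s|+|z_r-z_s|\le 3$). In the square grid $\mathbb{Z}^2$, the 8-neighborhood of a point $(x,y)$ consists of the points $(x',y')\in\mathbb{Z}^2$ with $\max\{|x-x'|,|y-y'|\}\le 1$. In either grid, a path of length $n$ from $q$ to $p$ in the given neighborhood is a sequence of grid points $q=r_0,r_1,\dots,r_n=p$ with $r_{t+1}$ in the neighborhood of $r_t$ for $0\le t<n$. A shortest path is a path of minimal length among all paths from $q$ to $p$ in the given neighborhood; two paths are distinct if they differ as sequences of points. -}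

module Defs where

open import Data.Fin.Base using (Fin)
open import Data.Integer.Base as ℤ using (ℤ; ∣_∣)
open import Data.List.Base using (map; filter; upTo)
open import Data.Nat.Base
  using (ℕ; suc; _+_; _*_; _∸_; _⊔_; _≤_; _!; _/_; NonZero)
open import Data.Nat.ListAction using (sum)
open import Data.Nat.Properties using (_≤?_; m*n≢0; _!≢0)
open import Data.Product.Base using (Σ; _×_; _,_; proj₁; proj₂)
open import Data.Vec.Base using (Vec; head; last)
open import Data.Vec.Relation.Unary.Linked using (Linked)
open import Function.Bundles using (Inverse)
open import Relation.Binary.Bundles using (Setoid)
open import Relation.Binary.Core using (Rel)
import Relation.Binary.Construct.On as On
open import Relation.Binary.PropositionalEquality using (_≡_; setoid)

Point² : Set
Point² = ℤ × ℤ

Point³ : Set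
Point³ = ℤ × ℤ × ℤ

-- `N r s` reads "s lies in the neighborhood of r"; every point is in its own
-- neighborhood.
N₈ : Rel Point² _
N₈ (x , y) (x′ , y′) = ∣ x ℤ.- x′ ∣ ⊔ ∣ y ℤ.- y′ ∣ ≤ 1

N₂₆ : Rel Point³ _
N₂₆ (x , y , z) (x′ , y′ , z′) =
  ∣ x ℤ.- x′ ∣ ⊔ ∣ y ℤ.- y′ ∣ ⊔ ∣ z ℤ.- z′ ∣ ≤ 1

module _ {P : Set} where

  -- Sequences r₀, …, rₙ: a sequence of length n has n + 1 points.
  Sequence : Set
  Sequence = Σ ℕ (λ n → Vec P (suc n))

  length : Sequence → ℕ
  length = proj₁

  record IsPath (N : Rel P _) (q p : P) (w : Sequence) : Set where
    private
      points : Vec P (suc (length w))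
      points = proj₂ w
    field
      starts : head points ≡ q
      ends   : last points ≡ p
      steps  : Linked N points

  record IsShortestPath (N : Rel P _) (q p : P) (w : Sequence) : Set where
    field
      isPath  : IsPath N q p w
      minimal : ∀ w′ → IsPath N q p w′ → length w ≤ length w′

-- Exactly n elements of A satisfy Q. Elements are compared in A alone, so
-- different proofs of Q for the same element are not counted twice.
NumberOf : {A : Set} (Q : A → Set) → ℕ → Set
NumberOf {A} Q n = Inverse satisfying (setoid (Fin n))
  where
  satisfying : Setoid _ _
  satisfying = On.setoid {B = Σ A Q} (setoid A) proj₁

-- For m ≤ n the three factorials in the denominator have arguments summing to n
-- whenever 2b ≤ n ∸ m, so the truncating division of ℕ is exact.
term : (n m b : ℕ) → ℕ
term n m b = n ! / (b ! * (m + b) ! * (n ∸ m ∸ 2 * b) !)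
  where
  instance
    nonZero : NonZero (b ! * (m + b) ! * (n ∸ m ∸ 2 * b) !)
    nonZero = m*n≢0 _ _ {{m*n≢0 _ _ {{b !≢0}} {{(m + b) !≢0}}}}
                        {{(n ∸ m ∸ 2 * b) !≢0}}

-- Sum of `term n m b` over all b with 2b ≤ n ∸ m; every such b is ≤ n ∸ m,
-- so the range filtered here loses none of them.
factor : (n m : ℕ) → ℕ
factor n m = sum (map (term n m) (filter (λ b → 2 * b ≤? n ∸ m) (upTo (suc (n ∸ m)))))

{-# OPTIONS --safe #-}
-- In one dimension the paths of length n with displacement d number
-- T n ∣ d ∣ = Σ_b n! / (b! (∣d∣+b)! (n-∣d∣-2b)!), where b counts the
-- steps against the sign of d; in particular there are none when n < ∣ d ∣ and exactly one
-- when n = ∣ d ∣. Both N₈ and N₂₆ are products of copies of the one-dimensional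
-- neighborhood, so a path in them is a tuple of independent one-dimensional
-- paths of a common length. The dominant coordinate i forces the minimal length
-- to be ∣ i ∣ and contributes a factor 1.
module Submission where

open import Defs
open import Data.Fin.Base using (zero; suc)
open import Data.Integer.Base as ℤ using (ℤ; -[1+_]; +[1+_]; ∣_∣; 0ℤ; 1ℤ; -1ℤ)
import Data.Integer.Properties as ℤ
open import Data.Integer.Tactic.RingSolver using (solve-∀)
open import Data.List.Base as List
  using (List; []; _∷_; [_]; _++_; applyUpTo; concatMap; cartesianProductWith; filter; upTo)
open import Data.List.Membership.Propositional using (_∈_; find)
open import Data.List.Membership.Propositional.Properties
  using (∈-concatMap⁺; ∈-concatMap⁻; ∈-map⁺; ∈-map⁻; ∈-lookup; ∈-length;
         ∈-cartesianProductWith⁺; ∈-cartesianProductWith⁻)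
open import Data.List.Properties using (length-++; length-map; map-upTo)
open import Data.List.Relation.Binary.Disjoint.Propositional using (Disjoint)
open import Data.List.Relation.Unary.All as All using ([]; _∷_)
import Data.List.Relation.Unary.All.Properties as All
open import Data.List.Relation.Unary.AllPairs as AllPairs using ([]; _∷_)
import Data.List.Relation.Unary.AllPairs.Properties as AllPairs
open import Data.List.Relation.Unary.Any as Any using (here; there; index)
open import Data.List.Relation.Unary.Any.Properties using (lookup-index)
open import Data.List.Relation.Unary.Unique.Propositional using (Unique)
import Data.List.Relation.Unary.Unique.Propositional.Properties as Unique
open import Data.Nat.Base
  using (ℕ; zero; suc; _+_; _*_; _∸_; _⊔_; _≤_; _<_; _≥_; _!; _/_; z≤n; s≤s; s≤s⁻¹; NonZero)
open import Data.Nat.DivMod using (m*n/n≡m; /-congˡ)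
open import Data.Nat.ListAction using (sum)
open import Data.Nat.Properties
open import Algebra.Properties.CommutativeSemigroup +-commutativeSemigroup
  using (interchange; xy∙z≈xz∙y; xy∙z≈zy∙x; xy∙z≈zx∙y)
import Data.Nat.Tactic.RingSolver as ℕSolver
open import Data.Product.Base using (_×_; _,_; proj₁; proj₂; ∃-syntax)
open import Data.Vec.Base as Vec using (Vec; []; _∷_)
open import Data.Vec.Relation.Unary.Linked as Linked using (Linked; [-]; _∷_)
import Data.Vec.Relation.Unary.Linked.Properties as Linked
open import Function.Base using (_∘_)
open import Relation.Binary.Core using (Rel)
open import Relation.Binary.PropositionalEquality
  using (_≡_; _≢_; refl; sym; trans; cong; cong₂; subst; module ≡-Reasoning)
open import Relation.Nullary using (¬_; yes; no; contradiction)
open import Relation.Unary using (Decidable)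

-- Finite sums over initial segments of the naturals

Σ< : ℕ → (ℕ → ℕ) → ℕ
Σ< K f = sum (applyUpTo f K)

Σ<-cong : ∀ K {f g} → (∀ b → f b ≡ g b) → Σ< K f ≡ Σ< K g
Σ<-cong zero    f≗g = refl
Σ<-cong (suc K) f≗g = cong₂ _+_ (f≗g 0) (Σ<-cong K (f≗g ∘ suc))

Σ<-distrib-+ : ∀ K f g → Σ< K (λ b → f b + g b) ≡ Σ< K f + Σ< K g
Σ<-distrib-+ zero    f g = refl
Σ<-distrib-+ (suc K) f g = begin
  f 0 + g 0 + Σ< K (λ b → f (suc b) + g (suc b))
    ≡⟨ cong ((f 0 + g 0) +_) (Σ<-distrib-+ K (f ∘ suc) (g ∘ suc)) ⟩
  f 0 + g 0 + (Σ< K (f ∘ suc) + Σ< K (g ∘ suc))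
    ≡⟨ interchange (f 0) (g 0) _ _ ⟩
  f 0 + Σ< K (f ∘ suc) + (g 0 + Σ< K (g ∘ suc))         ∎
  where open ≡-Reasoning

Σ<-zero : ∀ K {f} → (∀ b → f b ≡ 0) → Σ< K f ≡ 0
Σ<-zero zero    f≗0 = refl
Σ<-zero (suc K) f≗0 = cong₂ _+_ (f≗0 0) (Σ<-zero K (f≗0 ∘ suc))

Σ<-extend : ∀ {K L f} → K ≤ L → (∀ b → K ≤ b → f b ≡ 0) → Σ< L f ≡ Σ< K f
Σ<-extend {L = L} z≤n f≗0 = Σ<-zero L (λ b → f≗0 b z≤n)
Σ<-extend {f = f} (s≤s K≤L) f≗0 = cong (f 0 +_) (Σ<-extend K≤L (λ b K≤b → f≗0 (suc b) (s≤s K≤b)))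

sum-map-filter : {P : ℕ → Set} (P? : Decidable P) {f g : ℕ → ℕ} →
  (∀ x → P x → f x ≡ g x) → (∀ x → ¬ P x → g x ≡ 0) →
  ∀ xs → sum (List.map f (filter P? xs)) ≡ sum (List.map g xs)
sum-map-filter P? {f} f≡g g≡0 [] = refl
sum-map-filter P? {f} f≡g g≡0 (x ∷ xs) with P? x
... | yes px = cong₂ _+_ (f≡g x px) (sum-map-filter P? f≡g g≡0 xs)
... | no ¬px rewrite g≡0 x ¬px = sum-map-filter P? f≡g g≡0 xs

-- Trinomial coefficients

-- Multiplication of a generating function by its variable. The default 0 lets one clause of
-- `trinomial` split words by their first letter 0, +1 or -1, even when a or b is 0.
delay : (ℕ → ℕ) → ℕ → ℕ
delay f zero    = 0
delay f (suc a) = f a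

-- The number of words of length n over {+1, 0, -1} with a letters +1 and b
-- letters -1.
trinomial : ℕ → ℕ → ℕ → ℕ
trinomial zero    zero    zero    = 1
trinomial zero    zero    (suc b) = 0
trinomial zero    (suc a) b       = 0
trinomial (suc n) a       b       =
  trinomial n a b + delay (λ a′ → trinomial n a′ b) a + delay (trinomial n a) b

-- A word of length n has no room for more than n nonzero letters.
trinomial≡0 : ∀ n a b → n < a + b → trinomial n a b ≡ 0
trinomial≡0 zero    zero    (suc b) _ = refl
trinomial≡0 zero    (suc a) b       _ = refl
trinomial≡0 (suc n) a       b       n< =
  cong₂ _+_ (cong₂ _+_ (trinomial≡0 n a b (<⇒≤ n<)) (left a n<)) (right b n<)
  where
  left : ∀ a → suc n < a + b → delay (λ a′ → trinomial n a′ b) a ≡ 0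
  left zero    n< = refl
  left (suc a) n< = trinomial≡0 n a b (s≤s⁻¹ n<)
  right : ∀ b → suc n < a + b → delay (trinomial n a) b ≡ 0
  right zero    n< = refl
  right (suc b) n< = trinomial≡0 n a b (s≤s⁻¹ (subst (suc n <_) (+-suc a b) n<))

-- Negating every letter exchanges the letters +1 and -1.
trinomial-sym : ∀ n a b → trinomial n a b ≡ trinomial n b a
trinomial-sym zero    zero    zero    = refl
trinomial-sym zero    zero    (suc b) = refl
trinomial-sym zero    (suc a) zero    = refl
trinomial-sym zero    (suc a) (suc b) = refl
trinomial-sym (suc n) a       b       = begin
  trinomial n a b + delay (λ a′ → trinomial n a′ b) a + delay (trinomial n a) b
    ≡⟨ cong₂ _+_ (cong₂ _+_ (trinomial-sym n a b) (delayed a (λ a′ → trinomial-sym n a′ b)))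
                 (delayed b (trinomial-sym n a)) ⟩
  trinomial n b a + delay (trinomial n b) a + delay (λ b′ → trinomial n b′ a) b
    ≡⟨ xy∙z≈xz∙y (trinomial n b a) _ _ ⟩
  trinomial n b a + delay (λ b′ → trinomial n b′ a) b + delay (trinomial n b) a ∎
  where
  open ≡-Reasoning
  delayed : ∀ a {f g} → (∀ a′ → f a′ ≡ g a′) → delay f a ≡ delay g a
  delayed zero    f≗g = refl
  delayed (suc a) f≗g = f≗g a

-- The multinomial formula without division. By induction, the words of length n + 1 beginning with
-- 0, +1 and -1 contribute c, a and b times n !, and these coefficients add up to n + 1.
trinomial-! : ∀ n a b c → n ≡ a + b + c → trinomial n a b * (a ! * b ! * c !) ≡ n !
trinomial-! zero    zero zero zero _ = refl
trinomial-! (suc n) a    b    c    n≡ = begin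
  (trinomial n a b + delay (λ a′ → trinomial n a′ b) a + delay (trinomial n a) b) * (a ! * b ! * c !)
    ≡⟨ distrib (trinomial n a b) _ _ _ ⟩
  trinomial n a b * (a ! * b ! * c !)
    + delay (λ a′ → trinomial n a′ b) a * (a ! * b ! * c !)
    + delay (trinomial n a) b * (a ! * b ! * c !)
    ≡⟨ cong₂ _+_ (cong₂ _+_ (stay c n≡) (forward a n≡)) (backward b n≡) ⟩
  c * n ! + a * n ! + b * n !
    ≡⟨ collect a b c (n !) ⟩
  (a + b + c) * n !
    ≡⟨ cong (_* n !) n≡ ⟨
  suc n * n ! ∎
  where
  open ≡-Reasoning
  distrib : ∀ x y z w → (x + y + z) * w ≡ x * w + y * w + z * w
  distrib = ℕSolver.solve-∀
  collect : ∀ a b c f → c * f + a * f + b * f ≡ (a + b + c) * f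
  collect = ℕSolver.solve-∀
  pull₁ : ∀ t k u v w → t * ((k * u) * v * w) ≡ k * (t * (u * v * w))
  pull₁ = ℕSolver.solve-∀
  pull₂ : ∀ t k u v w → t * (u * (k * v) * w) ≡ k * (t * (u * v * w))
  pull₂ = ℕSolver.solve-∀
  pull₃ : ∀ t k u v w → t * (u * v * (k * w)) ≡ k * (t * (u * v * w))
  pull₃ = ℕSolver.solve-∀
  stay : ∀ c → suc n ≡ a + b + c → trinomial n a b * (a ! * b ! * c !) ≡ c * n !
  -- Without a letter 0 all n + 1 letters are nonzero, so n < a + b and the coefficient vanishes.
  stay zero n≡ =
    cong (_* (a ! * b ! * 1)) (trinomial≡0 n a b (≤-reflexive (trans n≡ (+-identityʳ _))))
  stay (suc c) n≡ = trans (pull₃ (trinomial n a b) (suc c) (a !) (b !) (c !))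
    (cong (suc c *_) (trinomial-! n a b c (suc-injective (trans n≡ (+-suc (a + b) c)))))
  forward : ∀ a → suc n ≡ a + b + c →
    delay (λ a′ → trinomial n a′ b) a * (a ! * b ! * c !) ≡ a * n !
  forward zero    n≡ = refl
  forward (suc a) n≡ = trans (pull₁ (trinomial n a b) (suc a) (a !) (b !) (c !))
    (cong (suc a *_) (trinomial-! n a b c (suc-injective n≡)))
  backward : ∀ b → suc n ≡ a + b + c → delay (trinomial n a) b * (a ! * b ! * c !) ≡ b * n !
  backward zero    n≡ = refl
  backward (suc b) n≡ = trans (pull₂ (trinomial n a b) (suc b) (a !) (b !) (c !))
    (cong (suc b *_) (trinomial-! n a b c (suc-injective (trans n≡ (cong (_+ c) (+-suc a b))))))

-- Words with a given sum

-- The number of words of length n over {+1, 0, -1} with sum m.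
T : ℕ → ℕ → ℕ
T n m = Σ< (suc n) (λ b → trinomial n (m + b) b)

-- Allows longer sums, which arise from the recurrence at n + 1, to be cut back to the range of
-- `T n`.
trinomial-tail : ∀ n m b → suc n ≤ b → trinomial n (m + b) b ≡ 0
trinomial-tail n m b n<b = trinomial≡0 n (m + b) b (≤-trans n<b (m≤n+m b (m + b)))

T≡0 : ∀ {n m} → n < m → T n m ≡ 0
T≡0 {n} {m} n<m = Σ<-zero (suc n) λ b →
  trinomial≡0 n (m + b) b (≤-trans n<m (≤-trans (m≤m+n m b) (m≤m+n (m + b) b)))

-- The summand for b = 0 suffices: multiplied by factorials it gives n !, which is nonzero.
T>0 : ∀ {n m} → m ≤ n → 0 < T n m
T>0 {n} {m} m≤n = ≤-trans (n≢0⇒n>0 tri≢0) (m≤m+n _ _)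
  where
  tri≢0 : ¬ trinomial n (m + 0) 0 ≡ 0
  tri≢0 tri≡0 = >⇒≢ (1≤n! n) (trans
    (sym (trinomial-! n (m + 0) 0 (n ∸ m)
      (trans (sym (m+[n∸m]≡n m≤n)) (cong (_+ (n ∸ m)) (sym (trans (+-identityʳ (m + 0)) (+-identityʳ m)))))))
    (cong (_* ((m + 0) ! * 1 * (n ∸ m) !)) tri≡0))

-- Only b = 0 survives, and the only word is the one with n letters +1.
T-diagonal : ∀ n → T n n ≡ 1
T-diagonal n = begin
  trinomial n (n + 0) 0 + Σ< n (λ b → trinomial n (n + suc b) (suc b))
    ≡⟨ cong₂ _+_ (cong (λ a → trinomial n a 0) (+-identityʳ n)) (Σ<-zero n λ b →
         trinomial≡0 n (n + suc b) (suc b) (≤-trans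
           (≤-trans (s≤s (m≤m+n n b)) (≤-reflexive (sym (+-suc n b))))
           (m≤m+n (n + suc b) (suc b)))) ⟩
  trinomial n n 0 + 0  ≡⟨ +-identityʳ _ ⟩
  trinomial n n 0      ≡⟨ *-cancelʳ-≡ _ 1 (n ! * 1 * 1) {{m*n≢0 _ _ {{m*n≢0 _ _ {{n !≢0}}}}}}
                            (trans (trinomial-! n n 0 0 (sym (trans (+-identityʳ _) (+-identityʳ n))))
                                   (unit (n !))) ⟩
  1 ∎
  where
  open ≡-Reasoning
  unit : ∀ x → x ≡ 1 * (x * 1 * 1)
  unit = ℕSolver.solve-∀

-- Split by the first letter: -1, 0 and +1 leave the sums m + 2, m + 1 and m for the rest of the
-- word.
T-suc-suc : ∀ n m → T (suc n) (suc m) ≡ T n (suc (suc m)) + T n (suc m) + T n m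
T-suc-suc n m = begin
  T (suc n) (suc m)
    -- The delayed summand is 0 at b = 0 by computation, so the third sum is reindexed by b + 1 and
    -- has one term fewer.
    ≡⟨ trans (Σ<-distrib-+ (suc (suc n)) (λ b → trinomial n (suc m + b) b + trinomial n (m + b) b)
                                        (λ b → delay (trinomial n (suc m + b)) b))
             (cong (_+ Σ< (suc n) (λ b → trinomial n (suc m + suc b) b))
                   (Σ<-distrib-+ (suc (suc n)) (λ b → trinomial n (suc m + b) b)
                                              (λ b → trinomial n (m + b) b))) ⟩
  Σ< (suc (suc n)) (λ b → trinomial n (suc m + b) b)
    + Σ< (suc (suc n)) (λ b → trinomial n (m + b) b)
    + Σ< (suc n) (λ b → trinomial n (suc m + suc b) b)
    ≡⟨ cong₂ _+_ (cong₂ _+_ (Σ<-extend (n≤1+n (suc n)) (trinomial-tail n (suc m)))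
                            (Σ<-extend (n≤1+n (suc n)) (trinomial-tail n m)))
                 (Σ<-cong (suc n) λ b → cong (λ a → trinomial n (suc a) b) (+-suc m b)) ⟩
  T n (suc m) + T n m + T n (suc (suc m))
    ≡⟨ xy∙z≈zx∙y (T n (suc m)) _ _ ⟩
  T n (suc (suc m)) + T n (suc m) + T n m ∎
  where open ≡-Reasoning

-- A first letter +1 leaves the sum -1, outside the index range of `T`; symmetry replaces it by the
-- sum 1.
T-suc-zero : ∀ n → T (suc n) 0 ≡ T n 1 + T n 0 + T n 1
T-suc-zero n = begin
  T (suc n) 0
    ≡⟨ trans (Σ<-distrib-+ (suc (suc n)) (λ b → trinomial n b b + delay (λ a → trinomial n a b) b)
                                        (λ b → delay (trinomial n b) b))
             (cong (_+ T n 1)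
                   (Σ<-distrib-+ (suc (suc n)) (λ b → trinomial n b b)
                                              (λ b → delay (λ a → trinomial n a b) b))) ⟩
  Σ< (suc (suc n)) (λ b → trinomial n b b) + Σ< (suc n) (λ b → trinomial n b (suc b)) + T n 1
    ≡⟨ cong (_+ T n 1) (cong₂ _+_ (Σ<-extend (n≤1+n (suc n)) (trinomial-tail n 0))
                                  (Σ<-cong (suc n) λ b → trinomial-sym n b (suc b))) ⟩
  T n 0 + T n 1 + T n 1
    ≡⟨ cong (_+ T n 1) (+-comm (T n 0) (T n 1)) ⟩
  T n 1 + T n 0 + T n 1 ∎
  where open ≡-Reasoning

-- Both recurrences in signed form, in the order of summands in which paths are enumerated below.
-- For negative d the outer two summands trade places.
T-suc-∣∣ : ∀ n d → T (suc n) ∣ d ∣ ≡ T n ∣ d ℤ.+ 1ℤ ∣ + T n ∣ d ℤ.+ 0ℤ ∣ + T n ∣ d ℤ.+ -1ℤ ∣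
T-suc-∣∣ n (ℤ.+ zero)   = T-suc-zero n
T-suc-∣∣ n +[1+ m ]     = trans (T-suc-suc n m)
  (cong₂ (λ x y → T n x + T n y + T n m) (cong suc (+-comm 1 m)) (sym (+-identityʳ (suc m))))
T-suc-∣∣ n -[1+ zero ]  = trans (T-suc-suc n 0) (xy∙z≈zy∙x (T n 2) (T n 1) (T n 0))
T-suc-∣∣ n -[1+ suc m ] = trans (T-suc-suc n (suc m))
  (trans (xy∙z≈zy∙x (T n (3 + m)) (T n (2 + m)) (T n (suc m)))
         (cong (λ x → T n (suc m) + T n (2 + m) + T n (3 + x)) (sym (+-identityʳ m))))

-- On the range of `factor` the quotient is exact and equals the trinomial coefficient. Outside it
-- 2b > n ∸ m, so a word would need m + 2b > n nonzero letters.
factor≡T : ∀ {n m} → m ≤ n → factor n m ≡ T n m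
factor≡T {n} {m} m≤n = begin
  factor n m
    ≡⟨ sum-map-filter (λ b → 2 * b ≤? n ∸ m) term≡ outside (upTo (suc (n ∸ m))) ⟩
  sum (List.map (λ b → trinomial n (m + b) b) (upTo (suc (n ∸ m))))
    ≡⟨ cong sum (map-upTo (λ b → trinomial n (m + b) b) (suc (n ∸ m))) ⟩
  Σ< (suc (n ∸ m)) (λ b → trinomial n (m + b) b)
    ≡⟨ Σ<-extend (s≤s (m∸n≤m n m))
         (λ b n∸m<b → outside b (<⇒≱ (≤-trans n∸m<b (m≤m+n b (b + 0))))) ⟨
  T n m ∎
  where
  open ≡-Reasoning
  regroup : ∀ m b → m + 2 * b ≡ m + b + b
  regroup = ℕSolver.solve-∀
  outside : ∀ b → ¬ 2 * b ≤ n ∸ m → trinomial n (m + b) b ≡ 0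
  outside b ≰ = trinomial≡0 n (m + b) b
    (subst (n <_) (regroup m b) (subst (_< m + 2 * b) (m+[n∸m]≡n m≤n) (+-monoʳ-< m (≰⇒> ≰))))
  regroup! : ∀ t x y z → t * (y * x * z) ≡ t * (x * y * z)
  regroup! = ℕSolver.solve-∀
  term≡ : ∀ b → 2 * b ≤ n ∸ m → term n m b ≡ trinomial n (m + b) b
  term≡ b 2b≤ = begin
    -- Writing n ! as a multiple of the denominator first makes the truncating division exact.
    n ! / den      ≡⟨ /-congˡ (sym (trans (regroup! t ((m + b) !) (b !) (c !))
                                           (trinomial-! n (m + b) b c n≡))) ⟩
    t * den / den  ≡⟨ m*n/n≡m t den ⟩
    t ∎
    where
    c = n ∸ m ∸ 2 * b
    t = trinomial n (m + b) b
    den = b ! * (m + b) ! * c !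
    instance
      den≢0 : NonZero den
      den≢0 = m*n≢0 _ _ {{m*n≢0 _ _ {{b !≢0}} {{(m + b) !≢0}}}} {{c !≢0}}
    n≡ : n ≡ m + b + b + c
    n≡ = begin
      n                     ≡⟨ m+[n∸m]≡n m≤n ⟨
      m + (n ∸ m)           ≡⟨ cong (m +_) (m+[n∸m]≡n 2b≤) ⟨
      m + (2 * b + c)       ≡⟨ +-assoc m (2 * b) c ⟨
      m + 2 * b + c         ≡⟨ cong (_+ c) (regroup m b) ⟩
      m + b + b + c         ∎

-- Counting by duplicate-free lists

lookup-injective : {A : Set} {xs : List A} → Unique xs →
  ∀ {i j} → List.lookup xs i ≡ List.lookup xs j → i ≡ j
lookup-injective (_ ∷ _)   {zero}  {zero}  _  = refl
lookup-injective (x≢ ∷ _)  {zero}  {suc j} eq = contradiction eq (All.lookup x≢ (∈-lookup j))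
lookup-injective (x≢ ∷ _)  {suc i} {zero}  eq = contradiction (sym eq) (All.lookup x≢ (∈-lookup i))
lookup-injective (_ ∷ xs!) {suc i} {suc j} eq = cong suc (lookup-injective xs! eq)

-- Position in the list and lookup at a position are mutually inverse.
numberOf-list : {A : Set} {Q : A → Set} {xs : List A} → Unique xs →
  (∀ {x} → x ∈ xs → Q x) → (∀ {x} → Q x → x ∈ xs) → NumberOf Q (List.length xs)
numberOf-list {xs = xs} xs! sound complete = record
  { to        = λ (_ , q) → index (complete q)
  ; from      = λ i → List.lookup xs i , sound (∈-lookup i)
  -- Different proofs of `Q` may yield different membership proofs, but without duplicates the
  -- position depends on the element alone.
  ; to-cong   = λ {(_ , q)} {(_ , q′)} x≡y → index-cong (complete q) (complete q′) x≡y
  ; from-cong = cong (List.lookup xs)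
  ; inverse   = (λ {i} {(_ , q)} x≡ → lookup-injective xs! (trans (sym (lookup-index (complete q))) x≡))
              , (λ {(_ , q)} i≡ → trans (cong (List.lookup xs) i≡) (sym (lookup-index (complete q))))
  }
  where
  index-cong : ∀ {x y} (x∈ : x ∈ xs) (y∈ : y ∈ xs) → x ≡ y → index x∈ ≡ index y∈
  index-cong x∈ y∈ x≡y = lookup-injective xs!
    (trans (sym (lookup-index x∈)) (trans x≡y (lookup-index y∈)))

-- Paths

module _ {P Q : Set} where

  last-map : (f : P → Q) → ∀ {n} (v : Vec P (suc n)) → Vec.last (Vec.map f v) ≡ f (Vec.last v)
  last-map f (x ∷ [])    = refl
  last-map f (x ∷ y ∷ v) = last-map f (y ∷ v)

  last-zip : ∀ {n} (v : Vec P (suc n)) (w : Vec Q (suc n)) →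
    Vec.last (Vec.zip v w) ≡ (Vec.last v , Vec.last w)
  last-zip (x ∷ [])    (y ∷ [])    = refl
  last-zip (x ∷ x′ ∷ v) (y ∷ y′ ∷ w) = last-zip (x′ ∷ v) (y′ ∷ w)

  zip-projections : ∀ {n} (v : Vec (P × Q) n) → Vec.zip (Vec.map proj₁ v) (Vec.map proj₂ v) ≡ v
  zip-projections []      = refl
  zip-projections (x ∷ v) = cong (x ∷_) (zip-projections v)

  zip-injective : ∀ {n} (v v′ : Vec P n) {w w′ : Vec Q n} →
    Vec.zip v w ≡ Vec.zip v′ w′ → v ≡ v′ × w ≡ w′
  zip-injective []      []       {[]}    {[]}     _  = refl , refl
  zip-injective (x ∷ v) (x′ ∷ v′) {y ∷ w} {y′ ∷ w′} eq
    with refl ← cong Vec.head eq | refl , refl ← zip-injective v v′ (cong Vec.tail eq) = refl , refl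

  map-isPath : {N : Rel P _} {N′ : Rel Q _} (f : P → Q) → (∀ {r s} → N r s → N′ (f r) (f s)) →
    ∀ {q p n v} → IsPath N q p (n , v) → IsPath N′ (f q) (f p) (n , Vec.map f v)
  map-isPath f mono {v = x ∷ v} record { starts = refl ; ends = refl ; steps = steps } = record
    { starts = refl
    ; ends   = last-map f (x ∷ v)
    ; steps  = Linked.map⁺ (Linked.map mono steps)
    }

  zip-isPath : {N : Rel P _} {N′ : Rel Q _} {N″ : Rel (P × Q) _} →
    (∀ {r s r′ s′} → N r s → N′ r′ s′ → N″ (r , r′) (s , s′)) →
    ∀ {q p q′ p′ n v w} → IsPath N q p (n , v) → IsPath N′ q′ p′ (n , w) →
    IsPath N″ (q , q′) (p , p′) (n , Vec.zip v w)
  zip-isPath {N} {N′} {N″} pair {v = x ∷ v} {w = y ∷ w}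
    record { starts = refl ; ends = refl ; steps = steps }
    record { starts = refl ; ends = refl ; steps = steps′ } = record
    { starts = refl
    ; ends   = last-zip (x ∷ v) (y ∷ w)
    ; steps  = zip-linked steps steps′
    }
    where
    zip-linked : ∀ {n} {v : Vec P n} {w : Vec Q n} → Linked N v → Linked N′ w → Linked N″ (Vec.zip v w)
    zip-linked Linked.[] Linked.[] = Linked.[]
    zip-linked [-]       [-]       = [-]
    zip-linked {v = _ ∷ _ ∷ _} {w = _ ∷ _ ∷ _} (r ∷ rs) (r′ ∷ rs′) = pair r r′ ∷ zip-linked rs rs′

-- The list holds bare point vectors of one fixed length, so its length counts paths and not proofs
-- of being a path.
record Enumerates {P : Set} (N : Rel P _) (q p : P) {n : ℕ} (vs : List (Vec P (suc n))) : Set where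
  field
    unique   : Unique vs
    sound    : ∀ {v} → v ∈ vs → IsPath N q p (n , v)
    complete : ∀ {v} → IsPath N q p (n , v) → v ∈ vs

open Enumerates

-- The first two arguments say that `N″` is the product of `N` and `N′`. Zipping and projecting then
-- match paths of length n in the product with pairs of paths of length n.
enumerates-× : {P Q : Set} {N : Rel P _} {N′ : Rel Q _} {N″ : Rel (P × Q) _} →
  (∀ {r s r′ s′} → N r s → N′ r′ s′ → N″ (r , r′) (s , s′)) →
  (∀ {r s} → N″ r s → N (proj₁ r) (proj₁ s) × N′ (proj₂ r) (proj₂ s)) →
  ∀ {q p q′ p′ n} {vs : List (Vec P (suc n))} {ws : List (Vec Q (suc n))} →
  Enumerates N q p vs → Enumerates N′ q′ p′ ws →
  Enumerates N″ (q , q′) (p , p′) (cartesianProductWith Vec.zip vs ws)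
enumerates-× {N″ = N″} pair unpair {vs = vs} {ws} V W = record
  { unique   = Unique.cartesianProductWith⁺ Vec.zip (zip-injective _ _) (unique V) (unique W)
  ; sound    = λ u∈ → sound′ (∈-cartesianProductWith⁻ Vec.zip vs ws u∈)
  ; complete = λ {u} path → subst (_∈ _) (zip-projections u)
      (∈-cartesianProductWith⁺ Vec.zip (complete V (map-isPath proj₁ (proj₁ ∘ unpair) path))
                                       (complete W (map-isPath proj₂ (proj₂ ∘ unpair) path)))
  }
  where
  sound′ : ∀ {u} → ∃[ v ] ∃[ w ] (v ∈ vs × w ∈ ws × u ≡ Vec.zip v w) → IsPath N″ _ _ (_ , u)
  sound′ (v , w , v∈ , w∈ , refl) = zip-isPath pair (sound V v∈) (sound W w∈)

length-cartesianProductWith : {A B C : Set} (f : A → B → C) → ∀ xs ys →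
  List.length (cartesianProductWith f xs ys) ≡ List.length xs * List.length ys
length-cartesianProductWith f []       ys = refl
length-cartesianProductWith f (x ∷ xs) ys =
  trans (length-++ (List.map (f x) ys))
        (cong₂ _+_ (length-map (f x) ys) (length-cartesianProductWith f xs ys))

-- A nonempty list exhibits a path of length n, so with the lower bound n is the minimal length. By
-- antisymmetry every shortest path has length n and is listed.
numberOf-shortest : {P : Set} {N : Rel P _} {q p : P} {n : ℕ} {vs : List (Vec P (suc n))} →
  Enumerates N q p vs → 0 < List.length vs → (∀ w → IsPath N q p w → n ≤ length w) →
  NumberOf (IsShortestPath N q p) (List.length vs)
numberOf-shortest {P} {N} {q} {p} {n} {vs@(v₀ ∷ vs′)} V _ n-minimal =
  subst (NumberOf (IsShortestPath N q p)) (length-map sequence vs)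
    (numberOf-list (Unique.map⁺ sequence-injective (unique V)) sound′ complete′)
  where
  sequence : Vec P (suc n) → Sequence
  sequence v = n , v
  sequence-injective : ∀ {v w} → sequence v ≡ sequence w → v ≡ w
  sequence-injective refl = refl
  sound′ : ∀ {w} → w ∈ List.map sequence (v₀ ∷ vs′) → IsShortestPath N q p w
  sound′ w∈ with v , v∈ , refl ← ∈-map⁻ sequence w∈ = record { isPath = sound V v∈ ; minimal = n-minimal }
  complete′ : ∀ {w} → IsShortestPath N q p w → w ∈ List.map sequence (v₀ ∷ vs′)
  complete′ {w@(m , v)} shortest
    with refl ← ≤-antisym (IsShortestPath.minimal shortest (n , v₀) (sound V (here refl)))
                          (n-minimal w (IsShortestPath.isPath shortest))
    = ∈-map⁺ sequence (complete V (IsShortestPath.isPath shortest))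

-- Paths on the integer line

N₂ : Rel ℤ _
N₂ x y = ∣ x ℤ.- y ∣ ≤ 1

-- The differences x - y from a point x to a next point y, with the sign used in `N₂`: the increment
-- d leads to x - d.
increments : List ℤ
increments = 1ℤ ∷ 0ℤ ∷ -1ℤ ∷ []

increments! : Unique increments
increments! = ((λ ()) ∷ (λ ()) ∷ []) ∷ ((λ ()) ∷ []) ∷ [] ∷ []

∈-increments⁺ : ∀ {d} → ∣ d ∣ ≤ 1 → d ∈ increments
∈-increments⁺ {ℤ.+ zero}    _ = there (here refl)
∈-increments⁺ {+[1+ zero ]} _ = here refl
∈-increments⁺ { -[1+ zero ]} _ = there (there (here refl))
∈-increments⁺ {+[1+ suc m ]} (s≤s ())
∈-increments⁺ { -[1+ suc m ]} (s≤s ())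

∈-increments⁻ : ∀ {d} → d ∈ increments → ∣ d ∣ ≤ 1
∈-increments⁻ (here refl)                 = s≤s z≤n
∈-increments⁻ (there (here refl))         = z≤n
∈-increments⁻ (there (there (here refl))) = s≤s z≤n

x-[x-y]≡y : ∀ x y → x ℤ.- (x ℤ.- y) ≡ y
x-[x-y]≡y = solve-∀

linePaths : ∀ n → ℤ → ℤ → List (Vec ℤ (suc n))
linePathsVia : ∀ n → ℤ → ℤ → ℤ → List (Vec ℤ (suc (suc n)))

linePaths zero    x p with x ℤ.≟ p
... | yes _ = [ x ∷ [] ]
... | no  _ = []
linePaths (suc n) x p = concatMap (linePathsVia n x p) increments

linePathsVia n x p d = List.map (x ∷_) (linePaths n (x ℤ.- d) p)

-- Both sides obey the same recurrence: after a first increment d the remaining displacement is p -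
-- x + d, as in `T-suc-∣∣`.
length-linePaths : ∀ n x p → List.length (linePaths n x p) ≡ T n ∣ p ℤ.- x ∣
length-linePaths zero    x p with x ℤ.≟ p
... | yes refl rewrite ℤ.+-inverseʳ x = refl
... | no  x≢p  with p ℤ.- x in eq
...   | ℤ.+ zero = contradiction (sym (ℤ.i-j≡0⇒i≡j p x eq)) x≢p
...   | +[1+ _ ] = refl
...   | -[1+ _ ] = refl
length-linePaths (suc n) x p = begin
  List.length (via 1ℤ ++ via 0ℤ ++ via -1ℤ ++ [])
    ≡⟨ trans (length-++ (via 1ℤ)) (cong (List.length (via 1ℤ) +_)
        (trans (length-++ (via 0ℤ)) (cong (List.length (via 0ℤ) +_)
          (trans (length-++ (via -1ℤ)) (+-identityʳ _))))) ⟩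
  List.length (via 1ℤ) + (List.length (via 0ℤ) + List.length (via -1ℤ))
    ≡⟨ +-assoc (List.length (via 1ℤ)) _ _ ⟨
  List.length (via 1ℤ) + List.length (via 0ℤ) + List.length (via -1ℤ)
    ≡⟨ cong₂ _+_ (cong₂ _+_ (length-via 1ℤ) (length-via 0ℤ)) (length-via -1ℤ) ⟩
  T n ∣ p ℤ.- x ℤ.+ 1ℤ ∣ + T n ∣ p ℤ.- x ℤ.+ 0ℤ ∣ + T n ∣ p ℤ.- x ℤ.+ -1ℤ ∣
    ≡⟨ T-suc-∣∣ n (p ℤ.- x) ⟨
  T (suc n) ∣ p ℤ.- x ∣ ∎
  where
  open ≡-Reasoning
  via : ℤ → List (Vec ℤ (suc (suc n)))
  via = linePathsVia n x p
  displacement : ∀ p x d → p ℤ.- (x ℤ.- d) ≡ p ℤ.- x ℤ.+ d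
  displacement = solve-∀
  length-via : ∀ d → List.length (via d) ≡ T n ∣ p ℤ.- x ℤ.+ d ∣
  length-via d = trans (length-map (x ∷_) (linePaths n (x ℤ.- d) p))
    (trans (length-linePaths n (x ℤ.- d) p) (cong (T n ∘ ∣_∣) (displacement p x d)))

linePaths-sound : ∀ n x p {v} → v ∈ linePaths n x p → IsPath N₂ x p (n , v)
linePaths-sound zero    x p v∈ with x ℤ.≟ p | v∈
... | yes refl | here refl = record { starts = refl ; ends = refl ; steps = [-] }
linePaths-sound (suc n) x p {v} v∈ = step (find (∈-concatMap⁻ (linePathsVia n x p) {xs = increments} v∈))
  where
  step : ∃[ d ] (d ∈ increments × v ∈ linePathsVia n x p d) → IsPath N₂ x p (suc n , v)
  step (d , d∈ , v∈via) with w , w∈ , refl ← ∈-map⁻ (x ∷_) v∈via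
    with w | linePaths-sound n (x ℤ.- d) p w∈
  ... | _ ∷ _ | record { starts = refl ; ends = ends ; steps = steps } = record
    { starts = refl
    ; ends   = ends
    ; steps  = subst (λ e → ∣ e ∣ ≤ 1) (sym (x-[x-y]≡y x d)) (∈-increments⁻ d∈) ∷ steps
    }

linePaths-complete : ∀ n x p {v} → IsPath N₂ x p (n , v) → v ∈ linePaths n x p
linePaths-complete zero    x p {_ ∷ []} record { starts = refl ; ends = refl } with x ℤ.≟ x
... | yes _  = here refl
... | no x≢x = contradiction refl x≢x
linePaths-complete (suc n) x p {_ ∷ y ∷ v} record { starts = refl ; ends = ends ; steps = step ∷ steps } =
  -- The first increment is read off the path as the difference of its first two points.
  ∈-concatMap⁺ (linePathsVia n x p) (Any.map via (∈-increments⁺ step))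
  where
  via : ∀ {d} → x ℤ.- y ≡ d → x ∷ y ∷ v ∈ linePathsVia n x p d
  via refl = ∈-map⁺ (x ∷_) (linePaths-complete n _ p
    record { starts = sym (x-[x-y]≡y x y) ; ends = ends ; steps = steps })

-- Sublists for distinct first increments d and e are disjoint: a common path would have second
-- point both x - d and x - e.
linePaths-unique : ∀ n x p → Unique (linePaths n x p)
linePaths-unique zero    x p with x ℤ.≟ p
... | yes _ = [] ∷ []
... | no  _ = []
linePaths-unique (suc n) x p = Unique.concat⁺
  (All.map⁺ (All.universal
    (λ d → Unique.map⁺ {f = x ∷_} (cong Vec.tail) (linePaths-unique n (x ℤ.- d) p)) increments))
  (AllPairs.map⁺ (AllPairs.map disjoint increments!))
  where
  disjoint : ∀ {d e} → d ≢ e → Disjoint (linePathsVia n x p d) (linePathsVia n x p e)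
  disjoint {d} {e} d≢e (v∈ , v∈′)
    with w , w∈ , refl ← ∈-map⁻ (x ∷_) v∈ | w , w∈′ , refl ← ∈-map⁻ (x ∷_) v∈′
    = d≢e (begin
        d                    ≡⟨ x-[x-y]≡y x d ⟨
        x ℤ.- (x ℤ.- d)      ≡⟨ cong (λ y → x ℤ.- y) (trans (sym (IsPath.starts (linePaths-sound n _ p w∈)))
                                                         (IsPath.starts (linePaths-sound n _ p w∈′))) ⟩
        x ℤ.- (x ℤ.- e)      ≡⟨ x-[x-y]≡y x e ⟩
        e                    ∎)
    where open ≡-Reasoning

linePaths-enumerates : ∀ n x p → Enumerates N₂ x p (linePaths n x p)
linePaths-enumerates n x p = record
  { unique   = linePaths-unique n x p
  ; sound    = linePaths-sound n x p
  ; complete = linePaths-complete n x p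
  }

length-linePaths₀ : ∀ n p → List.length (linePaths n 0ℤ p) ≡ T n ∣ p ∣
length-linePaths₀ n p = trans (length-linePaths n 0ℤ p) (cong (T n ∘ ∣_∣) (ℤ.+-identityʳ p))

-- By counting: for n < ∣ p ∣ the complete list of paths has length `T n ∣ p ∣`, which is 0, yet the
-- given path belongs to it.
∣displacement∣≤length : ∀ {p n v} → IsPath N₂ 0ℤ p (n , v) → ∣ p ∣ ≤ n
∣displacement∣≤length {p} {n} path = ≮⇒≥ λ n<∣p∣ →
  >⇒≢ (∈-length (linePaths-complete n 0ℤ p path)) (trans (length-linePaths₀ n p) (T≡0 n<∣p∣))

-- Paths in the square and cubic grids

squarePaths : ∀ n (i j : ℤ) → List (Vec Point² (suc n))
squarePaths n i j = cartesianProductWith Vec.zip (linePaths n 0ℤ i) (linePaths n 0ℤ j)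

cubicPaths : ∀ n (i j k : ℤ) → List (Vec Point³ (suc n))
cubicPaths n i j k = cartesianProductWith Vec.zip (linePaths n 0ℤ i) (squarePaths n j k)

N₈⁺ : ∀ {x y x′ y′} → N₂ x x′ → N₂ y y′ → N₈ (x , y) (x′ , y′)
N₈⁺ = ⊔-lub

N₈⁻ : ∀ {r s} → N₈ r s → N₂ (proj₁ r) (proj₁ s) × N₂ (proj₂ r) (proj₂ s)
N₈⁻ {x , y} {x′ , y′} ≤1 = m⊔n≤o⇒m≤o dx dy ≤1 , m⊔n≤o⇒n≤o dx dy ≤1
  where
  dx = ∣ x ℤ.- x′ ∣
  dy = ∣ y ℤ.- y′ ∣

N₂₆⁺ : ∀ {x x′ r s} → N₂ x x′ → N₈ r s → N₂₆ (x , r) (x′ , s)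
-- The maximum in `N₂₆` associates to the left, whereas triples nest to the right.
N₂₆⁺ {x} {x′} {y , z} {y′ , z′} x≤1 yz≤1 = subst (_≤ 1) (sym (⊔-assoc dx dy dz)) (⊔-lub x≤1 yz≤1)
  where
  dx = ∣ x ℤ.- x′ ∣
  dy = ∣ y ℤ.- y′ ∣
  dz = ∣ z ℤ.- z′ ∣

N₂₆⁻ : ∀ {r s} → N₂₆ r s → N₂ (proj₁ r) (proj₁ s) × N₈ (proj₂ r) (proj₂ s)
N₂₆⁻ {x , y , z} {x′ , y′ , z′} ≤1 = m⊔n≤o⇒m≤o dx (dy ⊔ dz) ≤1′ , m⊔n≤o⇒n≤o dx (dy ⊔ dz) ≤1′
  where
  dx = ∣ x ℤ.- x′ ∣
  dy = ∣ y ℤ.- y′ ∣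
  dz = ∣ z ℤ.- z′ ∣
  ≤1′ : dx ⊔ (dy ⊔ dz) ≤ 1
  ≤1′ = subst (_≤ 1) (⊔-assoc dx dy dz) ≤1

squarePaths-enumerates : ∀ n i j → Enumerates N₈ (0ℤ , 0ℤ) (i , j) (squarePaths n i j)
squarePaths-enumerates n i j =
  enumerates-× (λ {x} {x′} {y} {y′} → N₈⁺ {x} {y} {x′} {y′}) (λ {r} {s} → N₈⁻ {r} {s})
    (linePaths-enumerates n 0ℤ i) (linePaths-enumerates n 0ℤ j)

cubicPaths-enumerates : ∀ n i j k →
  Enumerates N₂₆ (0ℤ , 0ℤ , 0ℤ) (i , j , k) (cubicPaths n i j k)
cubicPaths-enumerates n i j k =
  enumerates-× (λ {x} {x′} {r} {s} → N₂₆⁺ {x} {x′} {r} {s}) (λ {r} {s} → N₂₆⁻ {r} {s})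
    (linePaths-enumerates n 0ℤ i) (squarePaths-enumerates n j k)

-- Counting the shortest paths

-- The length n is kept free because the cubic case needs planar paths to (j , k) of length ∣ i ∣,
-- which may exceed the minimal one.
length-squarePaths : ∀ n i j → ∣ i ∣ ≤ n → ∣ j ∣ ≤ n →
  List.length (squarePaths n i j) ≡ factor n ∣ i ∣ * factor n ∣ j ∣
length-squarePaths n i j i≤n j≤n = trans
  (length-cartesianProductWith Vec.zip (linePaths n 0ℤ i) (linePaths n 0ℤ j))
  (cong₂ _*_ (trans (length-linePaths₀ n i) (sym (factor≡T i≤n)))
             (trans (length-linePaths₀ n j) (sym (factor≡T j≤n))))

factor>0 : ∀ {n m} → m ≤ n → 0 < factor n m
factor>0 m≤n = subst (0 <_) (sym (factor≡T m≤n)) (T>0 m≤n)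

factor-diagonal : ∀ n → factor n n ≡ 1
factor-diagonal n = trans (factor≡T {n} ≤-refl) (T-diagonal n)

numberOf-N₈ : ∀ i j → ∣ i ∣ ≥ ∣ j ∣ →
  NumberOf (IsShortestPath N₈ (0ℤ , 0ℤ) (i , j)) (factor (∣ i ∣) (∣ j ∣))
numberOf-N₈ i j j≤i = subst (NumberOf _) count (numberOf-shortest (squarePaths-enumerates n i j)
  (subst (0 <_) (sym count) (factor>0 j≤i))
  -- Projection to the dominant coordinate bounds the length of every path from below by ∣ i ∣.
  (λ { (_ , _) path → ∣displacement∣≤length (map-isPath proj₁ (λ {r} {s} → proj₁ ∘ N₈⁻ {r} {s}) path) }))
  where
  n = ∣ i ∣
  count : List.length (squarePaths n i j) ≡ factor n ∣ j ∣
  count = trans (length-squarePaths n i j ≤-refl j≤i)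
    (trans (cong (_* factor n ∣ j ∣) (factor-diagonal n)) (*-identityˡ _))

numberOf-N₂₆ : ∀ i j k → ∣ i ∣ ≥ ∣ j ∣ → ∣ i ∣ ≥ ∣ k ∣ →
  NumberOf (IsShortestPath N₂₆ (0ℤ , 0ℤ , 0ℤ) (i , j , k)) (factor (∣ i ∣) (∣ j ∣) * factor (∣ i ∣) (∣ k ∣))
numberOf-N₂₆ i j k j≤i k≤i = subst (NumberOf _) count (numberOf-shortest (cubicPaths-enumerates n i j k)
  (subst (0 <_) (sym count) (*-mono-≤ (factor>0 j≤i) (factor>0 k≤i)))
  (λ { (_ , _) path → ∣displacement∣≤length (map-isPath proj₁ (λ {r} {s} → proj₁ ∘ N₂₆⁻ {r} {s}) path) }))
  where
  n = ∣ i ∣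
  count : List.length (cubicPaths n i j k) ≡ factor n ∣ j ∣ * factor n ∣ k ∣
  count = trans (length-cartesianProductWith Vec.zip (linePaths n 0ℤ i) (squarePaths n j k))
    -- At length ∣ i ∣ the first coordinate has a single path, so only the planar count remains.
    (trans (cong₂ _*_ (trans (length-linePaths₀ n i) (T-diagonal n)) (length-squarePaths n j k j≤i k≤i))
           (*-identityˡ _))

theorem5p2 : (i j k : ℤ) → ∣ i ∣ ≥ ∣ j ∣ → ∣ i ∣ ≥ ∣ k ∣ →
    ∃[ f₂₆ ] ∃[ f₈ij ] ∃[ f₈ik ]
    NumberOf (IsShortestPath N₂₆ (0ℤ , 0ℤ , 0ℤ) (i , j , k)) f₂₆
    × NumberOf (IsShortestPath N₈ (0ℤ , 0ℤ) (i , j)) f₈ij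
    × NumberOf (IsShortestPath N₈ (0ℤ , 0ℤ) (i , k)) f₈ik
    × f₂₆ ≡ factor (∣ i ∣) (∣ j ∣) * factor (∣ i ∣) (∣ k ∣)
    × f₂₆ ≡ f₈ij * f₈ik
    × f₈ij ≡ factor (∣ i ∣) (∣ j ∣)
    × f₈ik ≡ factor (∣ i ∣) (∣ k ∣)
theorem5p2 i j k j≤i k≤i =
  -- The three counts are inferred from these proofs as the closed forms themselves, so the
  -- equations hold by `refl`.
  _ , _ , _ , numberOf-N₂₆ i j k j≤i k≤i , numberOf-N₈ i j j≤i , numberOf-N₈ i k k≤i ,
  refl , refl , refl , refl
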